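{- For every $2$-coloring of the edges of the complete graph on the vertex set $\{\pm1\}^{78}$, there exist a vertex $u$ and four distinct coordinates $i,j,k,l \in \{1,\dots,78\}$ such that the four edges $\{u, u\oplus i\oplus j\}$, $\{u\oplus i \oplus j, u\oplus i\oplus j\oplus k\oplus l\}$, $\{u\oplus k\oplus l, u\oplus i\oplus j\oplus k\oplus l\}$, $\{u, u\oplus k\oplus l\}$ all have the same color (i.e., there is a monochromatic planar square whose sides have Hamming length $2$).
   Context: For a vertex $v \in \{\pm1\}^n$ and $1\le i\le n$, $v \oplus i$ denotes the vertex obtained from $v$ by flipping the sign of the $i$-th coordinate. Hamming length of an edge is the number of coordinates in which its endpoints differ. Only the four sides of the square are required to be monochromatic, not its diagonals. -}

module Defs where

open import Data.Bool using (Bool; not)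
open import Data.Nat using (ℕ)
open import Data.Fin using (Fin)
open import Data.Vec using (Vec; _[_]%=_)
open import Relation.Binary.PropositionalEquality using (_≡_)

-- Vertices of the hypercube {±1}^n, encoded with Bool (true ↔ +1, false ↔ -1).
Vertex : ℕ → Set
Vertex n = Vec Bool n

_⊕_ : ∀ {n} → Vertex n → Fin n → Vertex n
v ⊕ i = v [ i ]%= not

infixl 6 _⊕_

-- A 2-colouring of the edges of the complete graph on Vertex n:
-- a colour for every unordered pair, represented as a symmetric function.
-- (Values on the diagonal x = y are irrelevant and never used.)
record EdgeColouring (n : ℕ) : Set where
  field
    colour : Vertex n → Vertex n → Bool
    symmetric : ∀ x y → colour x y ≡ colour y x
open EdgeColouring public

{-# OPTIONS --safe #-}
-- Give each edge the sign ±1 of its colour and average over a uniform vertex and a uniform injective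
-- placement of 78 = 39 + 39 template positions on the coordinates. Four signs that are not all equal
-- have (x₁ + x₂ + x₃ + x₄)² = 2 − 2 x₁x₂x₃x₄. The square of a sum of signs over many disjoint pairs
-- at a vertex, or over many parallel edges with ends at pairwise distance two, is non-negative, so
-- two sides of a random square are on average almost uncorrelated or positively correlated. Without
-- monochromatic squares the left side above thus averages almost 4, and almost every square has
-- product −1. But in the product of two triangles each edge lies on two of the nine squares, so not
-- all nine products are −1, and a positive proportion of squares have product +1.
module Submission where

open import Defs
open import Data.Bool using (Bool; true; false; not; if_then_else_)
open import Data.Bool.Properties using (not-involutive) renaming (_≟_ to _≟ᵇ_)
open import Data.Fin using (Fin; zero; suc; splitAt; _↑ˡ_; _↑ʳ_)
open import Data.Fin.Properties using (any?; all?; ↑ˡ-injective; ↑ʳ-injective; splitAt-↑ˡ; splitAt-↑ʳ) renaming (_≟_ to _≟ᶠ_)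
open import Data.Fin.Permutation as Perm using (Permutation′; _⟨$⟩ʳ_; _⟨$⟩ˡ_; _∘ₚ_; transpose; remove; punchIn-permute; inverseʳ; inverseˡ)
open import Data.Integer hiding (suc)
open import Data.Integer.Properties
open import Data.Integer.Tactic.RingSolver using (solve-∀)
open import Data.List using (List; []; _∷_; _++_; map; allFin; filter; cartesianProductWith; length)
open import Data.List.Membership.Propositional using (_∈_)
open import Data.List.Membership.Propositional.Properties using (∈-cartesianProductWith⁺; ∈-allFin; ∈-filter⁺)
open import Data.List.Relation.Unary.All as All using (All; []; _∷_)
open import Data.List.Relation.Unary.All.Properties using (all-filter)
open import Data.List.Relation.Unary.AllPairs using (AllPairs; []; _∷_)
open import Data.List.Relation.Unary.Any using (here; there)
open import Data.List.Properties using (length-tabulate)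
open import Data.List.Relation.Unary.Unique.Propositional using (Unique)
open import Data.List.Relation.Unary.Unique.Propositional.Properties using (allFin⁺)
open import Data.Nat as ℕ using (ℕ; zero; suc)
open import Data.Product using (∃; ∃-syntax; _×_; _,_; proj₁; proj₂)
open import Data.Sum using (inj₁; inj₂)
open import Data.Vec using (Vec; []; _∷_; lookup; tabulate; insertAt; replicate)
open import Data.Vec.Properties using (lookup-replicate; lookup∘tabulate; tabulate-cong; tabulate∘lookup; insertAt-lookup; insertAt-punchIn; updateAt-commutes; updateAt-updateAt; updateAt-cong; updateAt-id)
open import Function using (_∘_; id; mk⇔)
open import Relation.Binary.PropositionalEquality using (_≡_; _≢_; refl; sym; trans; cong; cong₂; subst; module ≡-Reasoning)
open import Relation.Nullary using (Dec; yes; no; does; contradiction; ¬_)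
open import Relation.Nullary.Decidable using (does-⇔; map′; ¬?; _×-dec_; _⊎-dec_; decidable-stable; True; toWitness; _→-dec_; dec-true; dec-false)
open import Relation.Unary using (Decidable)

private
  variable
    A B : Set
    n N : ℕ

-- Finite sums

∑ : List A → (A → ℤ) → ℤ
∑ []       f = 0ℤ
∑ (x ∷ xs) f = f x + ∑ xs f

∑-cong : ∀ {f g : A → ℤ} {xs} → All (λ x → f x ≡ g x) xs → ∑ xs f ≡ ∑ xs g
∑-cong []       = refl
∑-cong (p ∷ ps) = cong₂ _+_ p (∑-cong ps)

∑-ext : ∀ {f g : A → ℤ} → (∀ x → f x ≡ g x) → ∀ xs → ∑ xs f ≡ ∑ xs g
∑-ext f≗g xs = ∑-cong (All.universal f≗g xs)

∑-mono-≤ : ∀ {f g : A → ℤ} {xs} → All (λ x → f x ≤ g x) xs → ∑ xs f ≤ ∑ xs g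
∑-mono-≤ []       = ≤-refl
∑-mono-≤ (p ∷ ps) = +-mono-≤ p (∑-mono-≤ ps)

∑-zero : ∀ (xs : List A) → ∑ xs (λ _ → 0ℤ) ≡ 0ℤ
∑-zero []       = refl
∑-zero (x ∷ xs) = trans (+-identityˡ _) (∑-zero xs)

∑-+ : ∀ (f g : A → ℤ) xs → ∑ xs (λ x → f x + g x) ≡ ∑ xs f + ∑ xs g
∑-+ f g []       = refl
∑-+ f g (x ∷ xs) = trans (cong (_+_ (f x + g x)) (∑-+ f g xs)) (lemma (f x) (g x) (∑ xs f) (∑ xs g))
  where
  lemma : ∀ a b c d → a + b + (c + d) ≡ a + c + (b + d)
  lemma = solve-∀

∑-* : ∀ c (f : A → ℤ) xs → ∑ xs (λ x → c * f x) ≡ c * ∑ xs f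
∑-* c f []       = sym (*-zeroʳ c)
∑-* c f (x ∷ xs) = trans (cong (_+_ (c * f x)) (∑-* c f xs)) (sym (*-distribˡ-+ c (f x) _))

∑-swap : ∀ (f : A → B → ℤ) xs ys → ∑ xs (λ x → ∑ ys (f x)) ≡ ∑ ys (λ y → ∑ xs (λ x → f x y))
∑-swap f []       ys = sym (∑-zero ys)
∑-swap f (x ∷ xs) ys = trans (cong (_+_ (∑ ys (f x))) (∑-swap f xs ys)) (sym (∑-+ (f x) _ ys))

∑-++ : ∀ (f : A → ℤ) xs ys → ∑ (xs ++ ys) f ≡ ∑ xs f + ∑ ys f
∑-++ f []       ys = sym (+-identityˡ _)
∑-++ f (x ∷ xs) ys = trans (cong (_+_ (f x)) (∑-++ f xs ys)) (sym (+-assoc (f x) _ _))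

∑-map : ∀ (h : A → B) (f : B → ℤ) xs → ∑ (map h xs) f ≡ ∑ xs (f ∘ h)
∑-map h f []       = refl
∑-map h f (x ∷ xs) = cong (_+_ (f (h x))) (∑-map h f xs)

∑-filter : ∀ {P : A → Set} (P? : Decidable P) (f : A → ℤ) xs →
  ∑ (filter P? xs) f ≡ ∑ xs (λ x → if does (P? x) then f x else 0ℤ)
∑-filter P? f []       = refl
∑-filter P? f (x ∷ xs) with does (P? x)
... | true  = cong (_+_ (f x)) (∑-filter P? f xs)
... | false = trans (∑-filter P? f xs) (sym (+-identityˡ _))

∑-nonneg : ∀ {f : A → ℤ} {xs} → All (λ x → 0ℤ ≤ f x) xs → 0ℤ ≤ ∑ xs f
∑-nonneg {f = f} {xs} ps = subst (_≤ ∑ xs f) (∑-zero xs) (∑-mono-≤ ps)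

∑-pos : ∀ {f : A → ℤ} {xs} → (∀ x → 0ℤ ≤ f x) → ∀ {x} → x ∈ xs → 0ℤ < f x → 0ℤ < ∑ xs f
∑-pos {xs = x ∷ xs} f≥0 (here refl) fx>0 = +-mono-<-≤ fx>0 (∑-nonneg (All.universal f≥0 xs))
∑-pos {xs = y ∷ xs} f≥0 (there x∈)  fx>0 = +-mono-≤-< (f≥0 y) (∑-pos f≥0 x∈ fx>0)

-- Sums over words

words : List A → ∀ N → List (Vec A N)
words xs zero    = [] ∷ []
words xs (suc N) = cartesianProductWith _∷_ xs (words xs N)

∑-cartesianProductWith : ∀ {C : Set} (h : A → B → C) (f : C → ℤ) xs ys →
  ∑ (cartesianProductWith h xs ys) f ≡ ∑ xs (λ x → ∑ ys (λ y → f (h x y)))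
∑-cartesianProductWith h f []       ys = refl
∑-cartesianProductWith h f (x ∷ xs) ys = trans (∑-++ f (map (h x) ys) _)
  (cong₂ _+_ (∑-map (h x) f ys) (∑-cartesianProductWith h f xs ys))

∈-words : ∀ {xs : List A} (v : Vec A N) → (∀ i → lookup v i ∈ xs) → v ∈ words xs N
∈-words []      v∈ = here refl
∈-words (x ∷ v) v∈ = ∈-cartesianProductWith⁺ _∷_ (v∈ zero) (∈-words v (v∈ ∘ suc))

-- Any position may serve as the outermost summation variable: the induction carries the letter past
-- the head by exchanging two sums. Sign flips at one coordinate and permutations of all positions
-- both reduce to this.
∑-words-insertAt : ∀ (xs : List A) N (i : Fin (suc N)) (f : Vec A (suc N) → ℤ) →
  ∑ (words xs (suc N)) f ≡ ∑ xs (λ a → ∑ (words xs N) (λ v → f (insertAt v i a)))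
∑-words-insertAt xs N zero f = ∑-cartesianProductWith _∷_ f xs (words xs N)
∑-words-insertAt xs (suc N) (suc i) f = begin
  ∑ (words xs (suc (suc N))) f
    ≡⟨ ∑-cartesianProductWith _∷_ f xs _ ⟩
  ∑ xs (λ b → ∑ (words xs (suc N)) (λ v → f (b ∷ v)))
    ≡⟨ ∑-ext (λ b → ∑-words-insertAt xs N i (f ∘ (b ∷_))) xs ⟩
  ∑ xs (λ b → ∑ xs (λ a → ∑ (words xs N) (λ v → f (b ∷ insertAt v i a))))
    ≡⟨ ∑-swap _ xs xs ⟩
  ∑ xs (λ a → ∑ xs (λ b → ∑ (words xs N) (λ v → f (b ∷ insertAt v i a))))
    ≡⟨ ∑-ext (λ a → sym (∑-cartesianProductWith _∷_ (λ v → f (insertAt v (suc i) a)) xs (words xs N))) xs ⟩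
  ∑ xs (λ a → ∑ (words xs (suc N)) (λ v → f (insertAt v (suc i) a)))
    ∎
  where open ≡-Reasoning

reindex : Permutation′ N → Vec A N → Vec A N
reindex σ v = tabulate (λ i → lookup v (σ ⟨$⟩ʳ i))

reindex-insertAt : ∀ (σ : Permutation′ (suc N)) (v : Vec A N) a →
  reindex σ (insertAt v (σ ⟨$⟩ʳ zero) a) ≡ a ∷ reindex (remove zero σ) v
reindex-insertAt σ v a = cong₂ _∷_ (insertAt-lookup v k a) (tabulate-cong λ i →
  trans (cong (lookup (insertAt v k a)) (punchIn-permute σ zero i)) (insertAt-punchIn v k a _))
  where k = σ ⟨$⟩ʳ zero

-- The head of the reindexed word is the letter at `σ ⟨$⟩ʳ zero`. Splitting off that position leaves
-- a shorter word reindexed by `remove zero σ`, to which induction applies.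
∑-words-reindex : ∀ (xs : List A) N (σ : Permutation′ N) (f : Vec A N → ℤ) →
  ∑ (words xs N) (f ∘ reindex σ) ≡ ∑ (words xs N) f
∑-words-reindex xs zero    σ f = refl
∑-words-reindex xs (suc N) σ f = begin
  ∑ (words xs (suc N)) (f ∘ reindex σ)
    ≡⟨ ∑-words-insertAt xs N (σ ⟨$⟩ʳ zero) _ ⟩
  ∑ xs (λ a → ∑ (words xs N) (λ v → f (reindex σ (insertAt v (σ ⟨$⟩ʳ zero) a))))
    ≡⟨ ∑-ext (λ a → ∑-ext (λ v → cong f (reindex-insertAt σ v a)) (words xs N)) xs ⟩
  ∑ xs (λ a → ∑ (words xs N) (λ v → f (a ∷ reindex (remove zero σ) v)))
    ≡⟨ ∑-ext (λ a → ∑-words-reindex xs N (remove zero σ) (f ∘ (a ∷_))) xs ⟩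
  ∑ xs (λ a → ∑ (words xs N) (λ v → f (a ∷ v)))
    ≡⟨ sym (∑-cartesianProductWith _∷_ f xs (words xs N)) ⟩
  ∑ (words xs (suc N)) f
    ∎
  where open ≡-Reasoning

-- The cube

bools : List Bool
bools = true ∷ false ∷ []

vertices : ∀ n → List (Vertex n)
vertices = words bools

-- With coordinate `i` summed outermost, the flip only exchanges the two terms of that sum.
∑-vertices-⊕ : ∀ (i : Fin n) (f : Vertex n → ℤ) → ∑ (vertices n) (λ u → f (u ⊕ i)) ≡ ∑ (vertices n) f
∑-vertices-⊕ {suc n} i f = begin
  ∑ (vertices (suc n)) (λ u → f (u ⊕ i))
    ≡⟨ ∑-words-insertAt bools n i _ ⟩
  ∑ bools (λ b → ∑ (vertices n) (λ u → f (insertAt u i b ⊕ i)))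
    ≡⟨ ∑-ext (λ b → ∑-ext (λ u → cong f (insertAt-⊕ u i b)) (vertices n)) bools ⟩
  ∑ bools (λ b → ∑ (vertices n) (λ u → f (insertAt u i (not b))))
    ≡⟨ swap (∑ (vertices n) (λ u → f (insertAt u i false))) (∑ (vertices n) (λ u → f (insertAt u i true))) ⟩
  ∑ bools (λ b → ∑ (vertices n) (λ u → f (insertAt u i b)))
    ≡⟨ sym (∑-words-insertAt bools n i f) ⟩
  ∑ (vertices (suc n)) f
    ∎
  where
  open ≡-Reasoning
  swap : ∀ a b → a + (b + 0ℤ) ≡ b + (a + 0ℤ)
  swap = solve-∀
  insertAt-⊕ : ∀ {n} (u : Vertex n) i b → insertAt u i b ⊕ i ≡ insertAt u i (not b)
  insertAt-⊕ u       zero    b = refl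
  insertAt-⊕ (_ ∷ u) (suc i) b = cong (_ ∷_) (insertAt-⊕ u i b)

⊕-comm : ∀ (u : Vertex n) i j → u ⊕ i ⊕ j ≡ u ⊕ j ⊕ i
⊕-comm u i j with i ≟ᶠ j
... | yes refl = refl
... | no  i≢j  = updateAt-commutes j i (i≢j ∘ sym) u

⊕-involutive : ∀ (u : Vertex n) i → u ⊕ i ⊕ i ≡ u
⊕-involutive u i = trans (updateAt-updateAt i u) (trans (updateAt-cong i not-involutive u) (updateAt-id i u))

-- Permutations

transpose-source : ∀ (p q : Fin N) → transpose p q ⟨$⟩ʳ p ≡ q
transpose-source p q rewrite dec-true (p ≟ᶠ p) refl = refl

transpose-minimal : ∀ {p q r : Fin N} → r ≢ p → r ≢ q → transpose p q ⟨$⟩ʳ r ≡ r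
transpose-minimal {p = p} {q} {r} r≢p r≢q
  rewrite dec-false (r ≟ᶠ p) r≢p | dec-false (r ≟ᶠ q) r≢q = refl

-- A list of (source, target) pairs that are pairwise compatible is a finite partial injection.
Compatible : (x y : Fin N × Fin N) → Set
Compatible (p , q) (p′ , q′) = p ≢ p′ × q ≢ q′

-- A partial injection extends to a permutation, one transposition per pair. The new one, applied
-- before `σ`, sends `p` to the preimage of `q`; every earlier source differs from both `p` and that
-- preimage, so its image is kept.
extend : ∀ {ps : List (Fin N × Fin N)} → AllPairs Compatible ps →
  ∃[ σ ] All (λ (p , q) → σ ⟨$⟩ʳ p ≡ q) ps
extend [] = Perm.id , []
extend {ps = (p , q) ∷ ps} (c ∷ cs) with extend cs
... | σ , maps = transpose p (σ ⟨$⟩ˡ q) ∘ₚ σ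
  , trans (cong (σ ⟨$⟩ʳ_) (transpose-source p _)) (inverseʳ σ)
  ∷ All.zipWith step (c , maps)
  where
  step : ∀ {x} → Compatible (p , q) x × σ ⟨$⟩ʳ proj₁ x ≡ proj₂ x →
    (transpose p (σ ⟨$⟩ˡ q) ∘ₚ σ) ⟨$⟩ʳ proj₁ x ≡ proj₂ x
  step ((p≢p′ , q≢q′) , σp′≡q′) = trans
    (cong (σ ⟨$⟩ʳ_) (transpose-minimal (p≢p′ ∘ sym)
      (λ p′≡ → q≢q′ (trans (sym (inverseʳ σ)) (trans (cong (σ ⟨$⟩ʳ_) (sym p′≡)) σp′≡q′)))))
    σp′≡q′

-- Averaging over injective placements

Injective : Vec (Fin n) N → Set
Injective v = ∀ i j → lookup v i ≡ lookup v j → i ≡ j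

injective? : Decidable (Injective {n} {N})
injective? v = all? λ i → all? λ j → (lookup v i ≟ᶠ lookup v j) →-dec (i ≟ᶠ j)

placements : ∀ n N → List (Vec (Fin n) N)
placements n N = filter injective? (words (allFin n) N)

reindex-injective : ∀ (σ : Permutation′ N) (v : Vec (Fin n) N) → Injective v → Injective (reindex σ v)
reindex-injective σ v inj i j eq = trans (sym (inverseˡ σ)) (trans (cong (σ ⟨$⟩ˡ_) (inj _ _
  (trans (sym (lookup∘tabulate _ i)) (trans eq (lookup∘tabulate _ j))))) (inverseˡ σ))

reindex-flip : ∀ (σ : Permutation′ N) (v : Vec A N) → reindex (Perm.flip σ) (reindex σ v) ≡ v
reindex-flip σ v = trans
  (tabulate-cong λ i → trans (lookup∘tabulate (λ j → lookup v (σ ⟨$⟩ʳ j)) (σ ⟨$⟩ˡ i)) (cong (lookup v) (inverseʳ σ)))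
  (tabulate∘lookup v)

-- Injectivity is invariant under reindexing, in both directions by way of the inverse permutation.
-- So the indicator of the filter is invariant too, and the symmetry of the sum over all words
-- carries over.
∑-placements-reindex : ∀ (σ : Permutation′ N) (f : Vec (Fin n) N → ℤ) →
  ∑ (placements n N) (f ∘ reindex σ) ≡ ∑ (placements n N) f
∑-placements-reindex {N} {n} σ f = begin
  ∑ (placements n N) (f ∘ reindex σ)
    ≡⟨ ∑-filter injective? (f ∘ reindex σ) all ⟩
  ∑ all (λ v → if does (injective? v) then f (reindex σ v) else 0ℤ)
    ≡⟨ ∑-ext (λ v → cong (λ b → if b then f (reindex σ v) else 0ℤ)
         (does-⇔ (mk⇔ (reindex-injective σ v)
           (λ inj → subst Injective (reindex-flip σ v) (reindex-injective (Perm.flip σ) (reindex σ v) inj)))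
           (injective? v) (injective? (reindex σ v)))) all ⟩
  ∑ all ((λ v → if does (injective? v) then f v else 0ℤ) ∘ reindex σ)
    ≡⟨ ∑-words-reindex (allFin n) N σ _ ⟩
  ∑ all (λ v → if does (injective? v) then f v else 0ℤ)
    ≡⟨ ∑-filter injective? f all ⟨
  ∑ (placements n N) f
    ∎
  where
  open ≡-Reasoning
  all = words (allFin n) N

Distinct : (i j k l : A) → Set
Distinct i j k l = i ≢ j × i ≢ k × i ≢ l × j ≢ k × j ≢ l × k ≢ l

square-nonneg : ∀ i → 0ℤ ≤ i * i
square-nonneg (+ n)    = subst (0ℤ ≤_) (pos-* n n) (+≤+ ℕ.z≤n)
square-nonneg -[1+ n ] = +≤+ ℕ.z≤n

module Averaging (n N : ℕ) where

  Statistic : Set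
  Statistic = Vertex n → Vec (Fin n) N → ℤ

  -- An expectation without its denominator: all values stay in ℤ, and `mass` stands for total
  -- probability one.
  E : Statistic → ℤ
  E f = ∑ (placements n N) λ v → ∑ (vertices n) λ u → f u v

  E-ext : ∀ {f g : Statistic} → (∀ u v → f u v ≡ g u v) → E f ≡ E g
  E-ext f≗g = ∑-ext (λ v → ∑-ext (λ u → f≗g u v) (vertices n)) (placements n N)

  E-ext-injective : ∀ {f g : Statistic} → (∀ u v → Injective v → f u v ≡ g u v) → E f ≡ E g
  E-ext-injective f≗g = ∑-cong (All.map (λ {v} inj → ∑-ext (λ u → f≗g u v inj) (vertices n))
    (all-filter injective? (words (allFin n) N)))

  E-mono-≤ : ∀ {f g : Statistic} → (∀ u v → f u v ≤ g u v) → E f ≤ E g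
  E-mono-≤ f≤g = ∑-mono-≤ (All.universal
    (λ v → ∑-mono-≤ (All.universal (λ u → f≤g u v) (vertices n))) (placements n N))

  E-+ : ∀ (f g : Statistic) → E (λ u v → f u v + g u v) ≡ E f + E g
  E-+ f g = trans (∑-ext (λ v → ∑-+ (λ u → f u v) (λ u → g u v) (vertices n)) (placements n N))
    (∑-+ _ _ (placements n N))

  E-* : ∀ c (f : Statistic) → E (λ u v → c * f u v) ≡ c * E f
  E-* c f = trans (∑-ext (λ v → ∑-* c (λ u → f u v) (vertices n)) (placements n N))
    (∑-* c _ (placements n N))

  E-0 : E (λ _ _ → 0ℤ) ≡ 0ℤ
  E-0 = trans (∑-ext (λ _ → ∑-zero (vertices n)) (placements n N)) (∑-zero (placements n N))

  -- The flipped coordinate may depend on the placement, because for each fixed placement the sum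
  -- over vertices is invariant under that flip.
  E-⊕ : ∀ (i : Vec (Fin n) N → Fin n) (f : Statistic) → E (λ u v → f (u ⊕ i v) v) ≡ E f
  E-⊕ i f = ∑-ext (λ v → ∑-vertices-⊕ (i v) (λ u → f u v)) (placements n N)

  E-⊕⊕ : ∀ (i j : Vec (Fin n) N → Fin n) (f : Statistic) → E (λ u v → f (u ⊕ i v ⊕ j v) v) ≡ E f
  E-⊕⊕ i j f = trans (E-⊕ i (λ u v → f (u ⊕ j v) v)) (E-⊕ j f)

  E-reindex : ∀ (σ : Permutation′ N) (f : Statistic) → E (λ u v → f u (reindex σ v)) ≡ E f
  E-reindex σ f = ∑-placements-reindex σ (λ v → ∑ (vertices n) (λ u → f u v))

  mass : ℤ
  mass = E (λ _ _ → 1ℤ)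

  E₄ : (i j k l : Fin N) → (Vertex n → (a b c d : Fin n) → ℤ) → ℤ
  E₄ i j k l f = E λ u v → f u (lookup v i) (lookup v j) (lookup v k) (lookup v l)

  -- Some permutation of the template positions carries one quadruple of distinct positions to the
  -- other, and `E` is invariant under reindexing.
  E₄-constant : ∀ {i j k l i′ j′ k′ l′ : Fin N} → Distinct i j k l → Distinct i′ j′ k′ l′ →
    ∀ (f : Vertex n → (a b c d : Fin n) → ℤ) → E₄ i j k l f ≡ E₄ i′ j′ k′ l′ f
  E₄-constant {i = i} {j} {k} {l} {i′} {j′} {k′} {l′} (ij , ik , il , jk , jl , kl) (ij′ , ik′ , il′ , jk′ , jl′ , kl′) f
    with extend {ps = (i , i′) ∷ (j , j′) ∷ (k , k′) ∷ (l , l′) ∷ []}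
      (((ij , ij′) ∷ (ik , ik′) ∷ (il , il′) ∷ []) ∷ ((jk , jk′) ∷ (jl , jl′) ∷ []) ∷ ((kl , kl′) ∷ []) ∷ [] ∷ [])
  ... | σ , σi ∷ σj ∷ σk ∷ σl ∷ [] = trans
    (sym (E-reindex σ (λ u v → f u (lookup v i) (lookup v j) (lookup v k) (lookup v l))))
    (E-ext λ u v → cong₄ (f u) (at v σi) (at v σj) (at v σk) (at v σl))
    where
    at : ∀ v {p q} → σ ⟨$⟩ʳ p ≡ q → lookup (reindex σ v) p ≡ lookup v q
    at v {p} σp = trans (lookup∘tabulate _ p) (cong (lookup v) σp)
    cong₄ : ∀ {A : Set} (g : A → A → A → A → ℤ) {a a′ b b′ c c′ d d′} →
      a ≡ a′ → b ≡ b′ → c ≡ c′ → d ≡ d′ → g a b c d ≡ g a′ b′ c′ d′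
    cong₄ g refl refl refl refl = refl

  -- Second moments

  E-∑-constant : ∀ {T : Set} (y : Statistic) (z : T → Statistic) C {ts} →
    All (λ t → E (λ u v → y u v * z t u v) ≡ C) ts →
    E (λ u v → y u v * ∑ ts (λ t → z t u v)) ≡ + length ts * C
  E-∑-constant y z C []               = trans (E-ext λ u v → *-zeroʳ (y u v)) E-0
  E-∑-constant y z C {t ∷ ts} (eq ∷ eqs) = begin
    E (λ u v → y u v * (z t u v + ∑ ts (λ s → z s u v)))
      ≡⟨ E-ext (λ u v → *-distribˡ-+ (y u v) (z t u v) _) ⟩
    E (λ u v → y u v * z t u v + y u v * ∑ ts (λ s → z s u v))
      ≡⟨ E-+ _ _ ⟩
    E (λ u v → y u v * z t u v) + E (λ u v → y u v * ∑ ts (λ s → z s u v))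
      ≡⟨ cong₂ _+_ eq (E-∑-constant y z C eqs) ⟩
    C + + length ts * C
      ≡⟨ lemma C (+ length ts) ⟩
    (1ℤ + + length ts) * C
      ∎
    where
    open ≡-Reasoning
    lemma : ∀ c k → c + k * c ≡ (1ℤ + k) * c
    lemma = solve-∀

  -- For k terms, the k diagonal products contribute `mass` each and the k(k - 1) ordered
  -- off-diagonal products contribute `C` each. The induction adds one new term and its cross
  -- products with the rest.
  second-moment : ∀ {T : Set} (z : T → Statistic) C {ts} →
    (∀ t u v → z t u v * z t u v ≡ 1ℤ) → Unique ts →
    (∀ {s t} → s ≢ t → E (λ u v → z s u v * z t u v) ≡ C) →
    E (λ u v → ∑ ts (λ t → z t u v) * ∑ ts (λ t → z t u v))
      ≡ + length ts * (mass + (+ length ts - 1ℤ) * C)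
  second-moment z C z² []                 corr = E-0
  second-moment z C {t ∷ ts} z² (t∉ ∷ uniq) corr = begin
    E (λ u v → (z t u v + S u v) * (z t u v + S u v))
      ≡⟨ E-ext (λ u v → trans (expand (z t u v) (S u v)) (cong (λ x → x + (+ 2 * (z t u v * S u v) + S u v * S u v)) (z² t u v))) ⟩
    E (λ u v → 1ℤ + (+ 2 * (z t u v * S u v) + S u v * S u v))
      ≡⟨ E-+ _ _ ⟩
    mass + E (λ u v → + 2 * (z t u v * S u v) + S u v * S u v)
      ≡⟨ cong (_+_ mass) (E-+ _ _) ⟩
    mass + (E (λ u v → + 2 * (z t u v * S u v)) + E (λ u v → S u v * S u v))
      ≡⟨ cong₂ (λ x y → mass + (x + y))
           (trans (E-* (+ 2) _) (cong (_*_ (+ 2)) (E-∑-constant (z t) z C (All.map corr t∉))))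
           (second-moment z C z² uniq corr) ⟩
    mass + (+ 2 * (k * C) + k * (mass + (k - 1ℤ) * C))
      ≡⟨ collect mass k C ⟩
    (1ℤ + k) * (mass + (1ℤ + k - 1ℤ) * C)
      ∎
    where
    open ≡-Reasoning
    k = + length ts
    S : Statistic
    S u v = ∑ ts (λ s → z s u v)
    expand : ∀ a b → (a + b) * (a + b) ≡ a * a + (+ 2 * (a * b) + b * b)
    expand = solve-∀
    collect : ∀ m k c → m + (+ 2 * (k * c) + k * (m + (k - 1ℤ) * c)) ≡ (1ℤ + k) * (m + (1ℤ + k - 1ℤ) * c)
    collect = solve-∀

  -- A second moment is a sum of squares. For m ≥ 2 this says that the common correlation `C` is at
  -- least -`mass` / (m - 1).
  average-correlation : ∀ {m} (z : Fin m → Statistic) C →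
    (∀ t u v → z t u v * z t u v ≡ 1ℤ) →
    (∀ {s t} → s ≢ t → E (λ u v → z s u v * z t u v) ≡ C) →
    0ℤ ≤ + m * (mass + (+ m - 1ℤ) * C)
  average-correlation {m} z C z² corr =
    subst (λ k → 0ℤ ≤ + k * (mass + (+ k - 1ℤ) * C)) (length-tabulate {n = m} id)
      (subst (0ℤ ≤_) (second-moment z C z² (allFin⁺ m) corr)
        (subst (_≤ E (λ u v → S u v * S u v)) E-0 (E-mono-≤ λ u v → square-nonneg (S u v))))
    where
    S : Statistic
    S u v = ∑ (allFin m) (λ t → z t u v)

-- With as many positions as coordinates the identity is an injective placement, so the sum has a
-- term equal to one.
mass-positive : ∀ n → 0ℤ < Averaging.mass n n
mass-positive n = ∑-pos (λ _ → ∑-nonneg (All.universal (λ _ → +≤+ ℕ.z≤n) (vertices n)))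
  (∈-filter⁺ injective? (∈-words identity (λ i → ∈-allFin (lookup identity i))) identity-injective)
  (∑-pos (λ _ → +≤+ ℕ.z≤n) (∈-words (replicate n true) true∈) (+<+ (ℕ.s≤s ℕ.z≤n)))
  where
  identity : Vec (Fin n) n
  identity = tabulate id
  identity-injective : Injective identity
  identity-injective i j eq = trans (sym (lookup∘tabulate id i)) (trans eq (lookup∘tabulate id j))
  true∈ : ∀ i → lookup (replicate n true) i ∈ bools
  true∈ i rewrite lookup-replicate i true = here refl

-- Signs

data IsSign : ℤ → Set where
  plus  : IsSign 1ℤ
  minus : IsSign -1ℤ

sgn : Bool → ℤ
sgn true  = 1ℤ
sgn false = -1ℤ

sgn-isSign : ∀ b → IsSign (sgn b)
sgn-isSign true  = plus
sgn-isSign false = minus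

isSign-* : ∀ {x y} → IsSign x → IsSign y → IsSign (x * y)
isSign-* plus  plus  = plus
isSign-* plus  minus = minus
isSign-* minus plus  = minus
isSign-* minus minus = plus

isSign-square : ∀ {x} → IsSign x → x * x ≡ 1ℤ
isSign-square plus  = refl
isSign-square minus = refl

decide : ∀ {x y} {_ : True (x ≤? y)} → x ≤ y
decide {_} {_} {x≤y} = toWitness x≤y

-- The product fixes the sum modulo 4: product 1 allows the sums 3 and -1, product -1 allows 1 and
-- -3. The bound is the smaller value in each case.
three-signs : ∀ {x y z} → IsSign x → IsSign y → IsSign z → x * y * z - + 2 ≤ x + y + z
three-signs plus  plus  plus  = decide
three-signs plus  plus  minus = decide
three-signs plus  minus plus  = decide
three-signs plus  minus minus = decide
three-signs minus plus  plus  = decide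
three-signs minus plus  minus = decide
three-signs minus minus plus  = decide
three-signs minus minus minus = decide

-- Two of three signs agree, so at most two of the three products are -1.
cyclic-products : ∀ {w₀ w₁ w₂} → IsSign w₀ → IsSign w₁ → IsSign w₂ →
  -1ℤ ≤ w₀ * w₁ + w₁ * w₂ + w₂ * w₀
cyclic-products plus  plus  plus  = decide
cyclic-products plus  plus  minus = decide
cyclic-products plus  minus plus  = decide
cyclic-products plus  minus minus = decide
cyclic-products minus plus  plus  = decide
cyclic-products minus plus  minus = decide
cyclic-products minus minus plus  = decide
cyclic-products minus minus minus = decide

-- Every horizontal edge of the prism lies on two of its squares, hence cancels in the product of the three.
prism : ∀ {h₀ h₁ h₂ w₀ w₁ w₂ w₀′ w₁′ w₂′} → IsSign h₀ → IsSign h₁ → IsSign h₂ →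
  IsSign w₀ → IsSign w₁ → IsSign w₂ → IsSign w₀′ → IsSign w₁′ → IsSign w₂′ →
  (w₀ * w₁ * w₂) * (w₀′ * w₁′ * w₂′) - + 2
    ≤ h₀ * w₀′ * h₁ * w₀ + h₁ * w₁′ * h₂ * w₁ + h₂ * w₂′ * h₀ * w₂
prism {h₀} {h₁} {h₂} {w₀} {w₁} {w₂} {w₀′} {w₁′} {w₂′} sh₀ sh₁ sh₂ s₀ s₁ s₂ s₀′ s₁′ s₂′ =
  ≤-trans (≤-reflexive (cong (_- + 2) (sym product)))
    (three-signs (side sh₀ s₀′ sh₁ s₀) (side sh₁ s₁′ sh₂ s₁) (side sh₂ s₂′ sh₀ s₂))
  where
  side : ∀ {a b c d} → IsSign a → IsSign b → IsSign c → IsSign d → IsSign (a * b * c * d)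
  side a b c d = isSign-* (isSign-* (isSign-* a b) c) d
  rearrange : ∀ h₀ h₁ h₂ w₀ w₁ w₂ w₀′ w₁′ w₂′ →
    (h₀ * w₀′ * h₁ * w₀) * (h₁ * w₁′ * h₂ * w₁) * (h₂ * w₂′ * h₀ * w₂)
      ≡ (h₀ * h₀) * (h₁ * h₁) * (h₂ * h₂) * ((w₀ * w₁ * w₂) * (w₀′ * w₁′ * w₂′))
  rearrange = solve-∀
  product : (h₀ * w₀′ * h₁ * w₀) * (h₁ * w₁′ * h₂ * w₁) * (h₂ * w₂′ * h₀ * w₂)
    ≡ (w₀ * w₁ * w₂) * (w₀′ * w₁′ * w₂′)
  product rewrite rearrange h₀ h₁ h₂ w₀ w₁ w₂ w₀′ w₁′ w₂′
    | isSign-square sh₀ | isSign-square sh₁ | isSign-square sh₂ = *-identityˡ _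

Monochromatic : (b₁ b₂ b₃ b₄ : Bool) → Set
Monochromatic b₁ b₂ b₃ b₄ = ∃[ col ] (b₁ ≡ col × b₂ ≡ col × b₃ ≡ col × b₄ ≡ col)

-- The square of the sum of four signs that are not all equal is 2 − 2π, where π is their product.
not-monochromatic : ∀ b₁ b₂ b₃ b₄ → ¬ Monochromatic b₁ b₂ b₃ b₄ →
  let x₁ = sgn b₁; x₂ = sgn b₂; x₃ = sgn b₃; x₄ = sgn b₄ in
  x₁ * x₂ + x₃ * x₄ + x₂ * x₃ + x₁ * x₄ + (x₁ * x₃ + x₂ * x₄) + x₁ * x₂ * x₃ * x₄ ≡ -1ℤ
not-monochromatic true  true  true  true  ¬mono = contradiction (true , refl , refl , refl , refl) ¬mono
not-monochromatic true  true  true  false ¬mono = refl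
not-monochromatic true  true  false true  ¬mono = refl
not-monochromatic true  true  false false ¬mono = refl
not-monochromatic true  false true  true  ¬mono = refl
not-monochromatic true  false true  false ¬mono = refl
not-monochromatic true  false false true  ¬mono = refl
not-monochromatic true  false false false ¬mono = refl
not-monochromatic false true  true  true  ¬mono = refl
not-monochromatic false true  true  false ¬mono = refl
not-monochromatic false true  false true  ¬mono = refl
not-monochromatic false true  false false ¬mono = refl
not-monochromatic false false true  true  ¬mono = refl
not-monochromatic false false true  false ¬mono = refl
not-monochromatic false false false true  ¬mono = refl
not-monochromatic false false false false ¬mono = contradiction (false , refl , refl , refl , refl) ¬mono

-- Colourings without monochromatic squares

MonochromaticSquare : EdgeColouring n → Vertex n → (i j k l : Fin n) → Set
MonochromaticSquare c u i j k l = Distinct i j k l × Monochromatic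
  (colour c u (u ⊕ i ⊕ j))
  (colour c (u ⊕ i ⊕ j) (u ⊕ i ⊕ j ⊕ k ⊕ l))
  (colour c (u ⊕ k ⊕ l) (u ⊕ i ⊕ j ⊕ k ⊕ l))
  (colour c u (u ⊕ k ⊕ l))

⊕⊕-comm : ∀ (u : Vertex n) i j k l → u ⊕ i ⊕ j ⊕ k ⊕ l ≡ u ⊕ k ⊕ l ⊕ i ⊕ j
⊕⊕-comm u i j k l = begin
  u ⊕ i ⊕ j ⊕ k ⊕ l  ≡⟨ cong (_⊕ l) (⊕-comm (u ⊕ i) j k) ⟩
  u ⊕ i ⊕ k ⊕ j ⊕ l  ≡⟨ cong (λ w → w ⊕ j ⊕ l) (⊕-comm u i k) ⟩
  u ⊕ k ⊕ i ⊕ j ⊕ l  ≡⟨ ⊕-comm (u ⊕ k ⊕ i) j l ⟩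
  u ⊕ k ⊕ i ⊕ l ⊕ j  ≡⟨ cong (_⊕ j) (⊕-comm (u ⊕ k) i l) ⟩
  u ⊕ k ⊕ l ⊕ i ⊕ j  ∎
  where open ≡-Reasoning

⊕⊕-involutive : ∀ (u : Vertex n) i j → u ⊕ i ⊕ j ⊕ i ⊕ j ≡ u
⊕⊕-involutive u i j = trans (cong (_⊕ j) (⊕-comm (u ⊕ i) j i))
  (trans (⊕-involutive (u ⊕ i ⊕ i) j) (⊕-involutive u i))

⊕-cancel : ∀ (u : Vertex n) a b a′ → u ⊕ a ⊕ b ⊕ a ⊕ a′ ≡ u ⊕ a′ ⊕ b
⊕-cancel u a b a′ = trans (cong (λ w → w ⊕ a ⊕ a′) (⊕-comm u a b))
  (trans (cong (_⊕ a′) (⊕-involutive (u ⊕ b) a)) (⊕-comm u b a′))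

module NoMonochromaticSquare (c : EdgeColouring n)
  (avoids : ∀ u i j k l → ¬ MonochromaticSquare c u i j k l) where

  χ : Vertex n → Fin n → Fin n → ℤ
  χ u a b = sgn (colour c u (u ⊕ a ⊕ b))

  χ-isSign : ∀ u a b → IsSign (χ u a b)
  χ-isSign u a b = sgn-isSign _

  χ-flip : ∀ u a b → χ (u ⊕ a ⊕ b) a b ≡ χ u a b
  χ-flip u a b = cong sgn (trans (cong (colour c (u ⊕ a ⊕ b)) (⊕⊕-involutive u a b))
    (symmetric c (u ⊕ a ⊕ b) u))

  -- These refer to the square spanned at `u` by the directions `a b` and `c d`: its two sides at
  -- `u`, its two parallel sides in direction `a b`, and all four sides.
  adjacent opposite product : Vertex n → (a b c d : Fin n) → ℤ
  adjacent u a b c d = χ u a b * χ u c d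
  opposite u a b c d = χ u a b * χ (u ⊕ c ⊕ d) a b
  product  u a b c d = χ u a b * χ (u ⊕ a ⊕ b) c d * χ (u ⊕ c ⊕ d) a b * χ u c d

  -- In the expansion of the squared sum of the four sides, each corner accounts for one pair of
  -- adjacent sides, and the two parallel pairs remain. Reading each adjacent pair from its own
  -- corner makes all four the same function of a translated vertex.
  square-relation : ∀ u {a b c d} → Distinct a b c d →
    adjacent (u ⊕ a ⊕ b) a b c d + adjacent (u ⊕ c ⊕ d) a b c d
      + adjacent (u ⊕ a ⊕ b ⊕ c ⊕ d) a b c d + adjacent u a b c d
      + (opposite u a b c d + opposite u c d a b) + product u a b c d ≡ -1ℤ
  square-relation u {a} {b} {k} {l} distinct = begin
    adjacent (u ⊕ a ⊕ b) a b k l + adjacent (u ⊕ k ⊕ l) a b k l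
      + adjacent (u ⊕ a ⊕ b ⊕ k ⊕ l) a b k l + adjacent u a b k l
      + (opposite u a b k l + opposite u k l a b) + product u a b k l
      ≡⟨ cong (λ x → x + adjacent u a b k l + (opposite u a b k l + opposite u k l a b) + product u a b k l)
           (cong₂ _+_ (cong₂ _+_
             (cong (_* χ (u ⊕ a ⊕ b) k l) (χ-flip u a b))
             (cong (_*_ (χ (u ⊕ k ⊕ l) a b)) (χ-flip u k l)))
             far) ⟩
    x₁ * x₂ + x₃ * x₄ + x₂ * x₃ + x₁ * x₄ + (x₁ * x₃ + opposite u k l a b) + x₁ * x₂ * x₃ * x₄
      ≡⟨ cong (λ y → x₁ * x₂ + x₃ * x₄ + x₂ * x₃ + x₁ * x₄ + (x₁ * x₃ + y) + x₁ * x₂ * x₃ * x₄) (*-comm x₄ x₂) ⟩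
    x₁ * x₂ + x₃ * x₄ + x₂ * x₃ + x₁ * x₄ + (x₁ * x₃ + x₂ * x₄) + x₁ * x₂ * x₃ * x₄
      -- `x₃` has its far end written as `u ⊕ k ⊕ l ⊕ a ⊕ b`; the forbidden square flips `a` and `b`
      -- first.
      ≡⟨ not-monochromatic _ _ _ _ (λ (col , e₁ , e₂ , e₃ , e₄) → avoids u a b k l
           (distinct , col , e₁ , e₂ , trans (cong (colour c (u ⊕ k ⊕ l)) (⊕⊕-comm u a b k l)) e₃ , e₄)) ⟩
    -1ℤ
      ∎
    where
    open ≡-Reasoning
    x₁ = χ u a b
    x₂ = χ (u ⊕ a ⊕ b) k l
    x₃ = χ (u ⊕ k ⊕ l) a b
    x₄ = χ u k l
    far : adjacent (u ⊕ a ⊕ b ⊕ k ⊕ l) a b k l ≡ x₂ * x₃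
    far = trans (cong₂ _*_
      (trans (cong (λ w → χ w a b) (⊕⊕-comm u a b k l)) (χ-flip (u ⊕ k ⊕ l) a b))
      (χ-flip (u ⊕ a ⊕ b) k l)) (*-comm x₃ x₂)

  -- Flipping `a` and `a′` at `u ⊕ a ⊕ b` replaces `a` by `a′`, and likewise for `b`. Thus the
  -- vertices `u ⊕ a ⊕ b`, with `a` and `b` ranging over two triples, form a product of two
  -- triangles with edges of Hamming length two.
  product-in-grid : ∀ u a a′ b b′ → product (u ⊕ a ⊕ b) a a′ b b′ ≡
    χ (u ⊕ a ⊕ b) a a′ * χ (u ⊕ a′ ⊕ b) b b′ * χ (u ⊕ a ⊕ b′) a a′ * χ (u ⊕ a ⊕ b) b b′
  product-in-grid u a a′ b b′ = cong₂
    (λ v w → χ (u ⊕ a ⊕ b) a a′ * χ v b b′ * χ w a a′ * χ (u ⊕ a ⊕ b) b b′)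
    (⊕-cancel u a b a′) (cong (_⊕ b′) (⊕-involutive (u ⊕ a) b))

  prism-products : ∀ u a a′ b₀ b₁ b₂ →
    (χ (u ⊕ a ⊕ b₀) b₀ b₁ * χ (u ⊕ a ⊕ b₁) b₁ b₂ * χ (u ⊕ a ⊕ b₂) b₂ b₀)
      * (χ (u ⊕ a′ ⊕ b₀) b₀ b₁ * χ (u ⊕ a′ ⊕ b₁) b₁ b₂ * χ (u ⊕ a′ ⊕ b₂) b₂ b₀) - + 2
    ≤ product (u ⊕ a ⊕ b₀) a a′ b₀ b₁ + product (u ⊕ a ⊕ b₁) a a′ b₁ b₂ + product (u ⊕ a ⊕ b₂) a a′ b₂ b₀
  prism-products u a a′ b₀ b₁ b₂
    rewrite product-in-grid u a a′ b₀ b₁ | product-in-grid u a a′ b₁ b₂ | product-in-grid u a a′ b₂ b₀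
    = prism (χ-isSign _ _ _) (χ-isSign _ _ _) (χ-isSign _ _ _) (χ-isSign _ _ _) (χ-isSign _ _ _)
        (χ-isSign _ _ _) (χ-isSign _ _ _) (χ-isSign _ _ _) (χ-isSign _ _ _)

  -- Each of the three prisms contributes at least the product of its two triangles `W`, minus 2.
  -- The cyclic sum of the products of triangles is at least -1, and -1 - 6 = -7, short of the -9
  -- that nine products -1 would give.
  grid-products : ∀ u a₀ a₁ a₂ b₀ b₁ b₂ →
    let row = λ a a′ → product (u ⊕ a ⊕ b₀) a a′ b₀ b₁ + product (u ⊕ a ⊕ b₁) a a′ b₁ b₂
                         + product (u ⊕ a ⊕ b₂) a a′ b₂ b₀ in
    - + 7 ≤ row a₀ a₁ + row a₁ a₂ + row a₂ a₀
  grid-products u a₀ a₁ a₂ b₀ b₁ b₂ = ≤-trans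
    (+-monoˡ-≤ (- + 6) (cyclic-products (W-isSign a₀) (W-isSign a₁) (W-isSign a₂)))
    (≤-trans (≤-reflexive (regroup (W a₀) (W a₁) (W a₂)))
      (+-mono-≤ (+-mono-≤ (prism-products u a₀ a₁ b₀ b₁ b₂) (prism-products u a₁ a₂ b₀ b₁ b₂))
        (prism-products u a₂ a₀ b₀ b₁ b₂)))
    where
    W : Fin n → ℤ
    W a = χ (u ⊕ a ⊕ b₀) b₀ b₁ * χ (u ⊕ a ⊕ b₁) b₁ b₂ * χ (u ⊕ a ⊕ b₂) b₂ b₀
    W-isSign : ∀ a → IsSign (W a)
    W-isSign a = isSign-* (isSign-* (χ-isSign _ _ _) (χ-isSign _ _ _)) (χ-isSign _ _ _)
    regroup : ∀ x y z → x * y + y * z + z * x + - + 6 ≡ x * y - + 2 + (y * z - + 2) + (z * x - + 2)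
    regroup = solve-∀

  -- Averaging the square relation

  module _ {N : ℕ} where
    open Averaging n N

    E-+₃ : ∀ (f g h : Statistic) → E (λ u v → f u v + g u v + h u v) ≡ E f + E g + E h
    E-+₃ f g h = trans (E-+ (λ u v → f u v + g u v) h) (cong (_+ E h) (E-+ f g))

    distinct-lookup : ∀ {i j k l : Fin N} {v : Vec (Fin n) N} → Injective v → Distinct i j k l →
      Distinct (lookup v i) (lookup v j) (lookup v k) (lookup v l)
    distinct-lookup inj (ij , ik , il , jk , jl , kl) =
      ij ∘ inj _ _ , ik ∘ inj _ _ , il ∘ inj _ _ , jk ∘ inj _ _ , jl ∘ inj _ _ , kl ∘ inj _ _

    -- Translating the vertex makes the four adjacent terms equal on average, and exchanging the
    -- position pairs `i j` and `k l` does the same for the two opposite terms.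
    average-relation : ∀ {i j k l} → Distinct i j k l →
      + 4 * E₄ i j k l adjacent + + 2 * E₄ i j k l opposite + E₄ i j k l product ≡ -1ℤ * mass
    average-relation {i} {j} {k} {l} distinct@(ij , ik , il , jk , jl , kl) = begin
      + 4 * α + + 2 * β + π
        ≡⟨ split α β π ⟩
      α + α + α + α + (β + β) + π
        ≡⟨ cong₂ (λ x y → x + α + y + π) (cong₂ _+_ (cong₂ _+_ (sym near) (sym near′)) (sym far))
             (cong (_+_ β) (sym opposite-swap)) ⟩
      E f₁ + E f₂ + E f₃ + α + (β + β′) + π
        ≡⟨ cong₂ (λ x y → x + α + y + π) (sym (E-+₃ f₁ f₂ f₃)) (sym (E-+ f₅ f₆)) ⟩
      E (λ u v → f₁ u v + f₂ u v + f₃ u v) + α + E (λ u v → f₅ u v + f₆ u v) + π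
        ≡⟨ cong (_+ π) (sym (E-+₃ (λ u v → f₁ u v + f₂ u v + f₃ u v) f₄ (λ u v → f₅ u v + f₆ u v))) ⟩
      E (λ u v → f₁ u v + f₂ u v + f₃ u v + f₄ u v + (f₅ u v + f₆ u v)) + π
        ≡⟨ sym (E-+ (λ u v → f₁ u v + f₂ u v + f₃ u v + f₄ u v + (f₅ u v + f₆ u v)) f₇) ⟩
      E (λ u v → f₁ u v + f₂ u v + f₃ u v + f₄ u v + (f₅ u v + f₆ u v) + f₇ u v)
        -- The relation holds only for four distinct coordinates, which injectivity of the placement
        -- supplies.
        ≡⟨ E-ext-injective (λ u v inj → square-relation u (distinct-lookup {v = v} inj distinct)) ⟩
      E (λ _ _ → -1ℤ)
        ≡⟨ E-* -1ℤ (λ _ _ → 1ℤ) ⟩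
      -1ℤ * mass
        ∎
      where
      open ≡-Reasoning
      α  = E₄ i j k l adjacent
      β  = E₄ i j k l opposite
      β′ = E₄ k l i j opposite
      π  = E₄ i j k l product
      f₁ f₂ f₃ f₄ f₅ f₆ f₇ : Statistic
      f₄ u v = adjacent u (lookup v i) (lookup v j) (lookup v k) (lookup v l)
      f₁ u v = f₄ (u ⊕ lookup v i ⊕ lookup v j) v
      f₂ u v = f₄ (u ⊕ lookup v k ⊕ lookup v l) v
      f₃ u v = f₄ (u ⊕ lookup v i ⊕ lookup v j ⊕ lookup v k ⊕ lookup v l) v
      f₅ u v = opposite u (lookup v i) (lookup v j) (lookup v k) (lookup v l)
      f₆ u v = opposite u (lookup v k) (lookup v l) (lookup v i) (lookup v j)
      f₇ u v = product u (lookup v i) (lookup v j) (lookup v k) (lookup v l)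
      near : E f₁ ≡ α
      near = E-⊕⊕ (λ v → lookup v i) (λ v → lookup v j) f₄
      near′ : E f₂ ≡ α
      near′ = E-⊕⊕ (λ v → lookup v k) (λ v → lookup v l) f₄
      far : E f₃ ≡ α
      far = trans (E-⊕⊕ (λ v → lookup v i) (λ v → lookup v j) f₂) near′
      opposite-swap : β′ ≡ β
      opposite-swap = E₄-constant (kl , ik ∘ sym , jk ∘ sym , il ∘ sym , jl ∘ sym , ij) distinct opposite
      split : ∀ a b p → + 4 * a + + 2 * b + p ≡ a + a + a + a + (b + b) + p
      split = solve-∀

    -- Bounds on the three averages

    module Template {m} (p q : Fin m → Fin N) (p-injective : ∀ {s t} → p s ≡ p t → s ≡ t)
      (q-injective : ∀ {s t} → q s ≡ q t → s ≡ t) (p≢q : ∀ s t → p s ≢ q t)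
      {r₀ r₁ r₂ : Fin m} (r₀≢r₁ : r₀ ≢ r₁) (r₁≢r₂ : r₁ ≢ r₂) (r₂≢r₀ : r₂ ≢ r₀) where

      distinct-ppqq : ∀ {s s′ t t′} → s ≢ s′ → t ≢ t′ → Distinct (p s) (p s′) (q t) (q t′)
      distinct-ppqq s≢s′ t≢t′ = s≢s′ ∘ p-injective , p≢q _ _ , p≢q _ _ , p≢q _ _ , p≢q _ _ , t≢t′ ∘ q-injective

      distinct-pqpq : ∀ {s t} → s ≢ t → Distinct (p s) (q s) (p t) (q t)
      distinct-pqpq s≢t = p≢q _ _ , s≢t ∘ p-injective , p≢q _ _ , p≢q _ _ ∘ sym , s≢t ∘ q-injective , p≢q _ _

      reference : Distinct (p r₀) (p r₁) (q r₀) (q r₁)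
      reference = distinct-ppqq r₀≢r₁ r₀≢r₁

      α β π : ℤ
      α = E₄ (p r₀) (p r₁) (q r₀) (q r₁) adjacent
      β = E₄ (p r₀) (p r₁) (q r₀) (q r₁) opposite
      π = E₄ (p r₀) (p r₁) (q r₀) (q r₁) product

      -- The `m` edges at `u` in the disjoint directions `p t`, `q t` are pairwise adjacent sides of
      -- squares.
      adjacent-bound : 0ℤ ≤ + m * (mass + (+ m - 1ℤ) * α)
      adjacent-bound = average-correlation (λ t u v → χ u (lookup v (p t)) (lookup v (q t))) α
        (λ t u v → isSign-square (χ-isSign u _ _))
        (λ s≢t → E₄-constant (distinct-pqpq s≢t) reference adjacent)

      -- The `m` parallel edges in direction `p r₀`, `p r₁` start at the vertices `u ⊕ q t`, which
      -- are pairwise at distance two, so any two edges are opposite sides of a square.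
      opposite-bound : 0ℤ ≤ + m * (mass + (+ m - 1ℤ) * β)
      opposite-bound = average-correlation z β (λ t u v → isSign-square (χ-isSign (u ⊕ lookup v (q t)) _ _)) corr
        where
        z : Fin m → Statistic
        z t u v = χ (u ⊕ lookup v (q t)) (lookup v (p r₀)) (lookup v (p r₁))
        corr : ∀ {s t} → s ≢ t → E (λ u v → z s u v * z t u v) ≡ β
        corr {s} {t} s≢t = begin
          E (λ u v → z s u v * z t u v)
            -- Writing `u` as `u ⊕ q s ⊕ q s` exhibits the second edge as a translate of the first
            -- by `q s` and `q t`, with base vertex `u ⊕ q s`.
            ≡⟨ E-ext (λ u v → cong (λ w → z s u v * χ (w ⊕ lookup v (q t)) (lookup v (p r₀)) (lookup v (p r₁)))
                 (sym (⊕-involutive u (lookup v (q s))))) ⟩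
          E (λ u v → f (u ⊕ lookup v (q s)) v)
            ≡⟨ E-⊕ (λ v → lookup v (q s)) f ⟩
          E₄ (p r₀) (p r₁) (q s) (q t) opposite
            ≡⟨ E₄-constant (distinct-ppqq r₀≢r₁ s≢t) reference opposite ⟩
          β
            ∎
          where
          open ≡-Reasoning
          f : Statistic
          f u v = opposite u (lookup v (p r₀)) (lookup v (p r₁)) (lookup v (q s)) (lookup v (q t))

      -- The grid on the triples `p r₀`, `p r₁`, `p r₂` and `q r₀`, `q r₁`, `q r₂` has nine squares,
      -- and each has average `π` by translation of its base vertex and symmetry of the positions.
      product-bound : - + 7 * mass ≤ + 9 * π
      product-bound = begin
        - + 7 * mass
          ≡⟨ sym (E-* (- + 7) (λ _ _ → 1ℤ)) ⟩
        E (λ _ _ → - + 7)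
          ≤⟨ E-mono-≤ (λ u v → grid-products u (lookup v (p r₀)) (lookup v (p r₁)) (lookup v (p r₂))
               (lookup v (q r₀)) (lookup v (q r₁)) (lookup v (q r₂))) ⟩
        E (λ u v → row r₀ r₁ u v + row r₁ r₂ u v + row r₂ r₀ u v)
          ≡⟨ E-+₃ (row r₀ r₁) (row r₁ r₂) (row r₂ r₀) ⟩
        E (row r₀ r₁) + E (row r₁ r₂) + E (row r₂ r₀)
          ≡⟨ cong₂ _+_ (cong₂ _+_ (E-row r₀≢r₁) (E-row r₁≢r₂)) (E-row r₂≢r₀) ⟩
        π + π + π + (π + π + π) + (π + π + π)
          ≡⟨ nine π ⟩
        + 9 * π
          ∎
        where
        open ≤-Reasoning
        cell : (s s′ t t′ : Fin m) → Statistic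
        cell s s′ t t′ u v = product (u ⊕ lookup v (p s) ⊕ lookup v (q t))
          (lookup v (p s)) (lookup v (p s′)) (lookup v (q t)) (lookup v (q t′))
        row : (s s′ : Fin m) → Statistic
        row s s′ u v = cell s s′ r₀ r₁ u v + cell s s′ r₁ r₂ u v + cell s s′ r₂ r₀ u v
        E-cell : ∀ {s s′ t t′} → s ≢ s′ → t ≢ t′ → E (cell s s′ t t′) ≡ π
        E-cell {s} {s′} {t} {t′} s≢s′ t≢t′ = trans
          (E-⊕⊕ (λ v → lookup v (p s)) (λ v → lookup v (q t))
            (λ u v → product u (lookup v (p s)) (lookup v (p s′)) (lookup v (q t)) (lookup v (q t′))))
          (E₄-constant (distinct-ppqq s≢s′ t≢t′) reference product)
        E-row : ∀ {s s′} → s ≢ s′ → E (row s s′) ≡ π + π + π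
        E-row {s} {s′} s≢s′ = trans (E-+₃ (cell s s′ r₀ r₁) (cell s s′ r₁ r₂) (cell s s′ r₂ r₀))
          (cong₂ _+_ (cong₂ _+_ (E-cell s≢s′ r₀≢r₁) (E-cell s≢s′ r₁≢r₂)) (E-cell s≢s′ r₂≢r₀))
        nine : ∀ x → x + x + x + (x + x + x) + (x + x + x) ≡ + 9 * x
        nine = solve-∀

-- Elimination of the averages

-- The averages become anonymous integers here, which separates the final arithmetic from the sums
-- over the cube.
Bounds : ℕ → Set
Bounds m = ∃[ M ] ∃[ α ] ∃[ β ] ∃[ π ]
  (0ℤ < M × + 4 * α + + 2 * β + π ≡ -1ℤ * M × - + 7 * M ≤ + 9 * π
    × 0ℤ ≤ + m * (M + (+ m - 1ℤ) * α) × 0ℤ ≤ + m * (M + (+ m - 1ℤ) * β))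

-- The weights 36, 18 and 1482 = 39 · 38 of the three bounds eliminate α, β and π through the relation.
bounds-contradict : ¬ Bounds 39
bounds-contradict (M , α , β , π , M>0 , relation , π-bound , α-bound , β-bound) = <⇒≱ M>0
  -- The weighted relation has coefficient 13338 = 9 · 38 · 39 at `M`, while the bounds supply 36 ·
  -- 39 + 18 · 39 + 7 · 1482 = 12480; the difference is 858.
  (*-cancelˡ-≤-pos M 0ℤ (+ 858) (begin
    + 858 * M
      ≡⟨ sym (+-identityʳ _) ⟩
    + 858 * M + 0ℤ
      ≤⟨ +-monoʳ-≤ (+ 858 * M) (+-mono-≤ (+-mono-≤
           (*-monoˡ-≤-nonNeg (+ 36) α-bound) (*-monoˡ-≤-nonNeg (+ 18) β-bound))
           (*-monoˡ-≤-nonNeg (+ 1482) (i≤j⇒0≤j-i π-bound))) ⟩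
    + 858 * M + (+ 36 * (+ 39 * (M + + 38 * α)) + + 18 * (+ 39 * (M + + 38 * β))
                  + + 1482 * (+ 9 * π - - + 7 * M))
      ≡⟨ balance M α β π ⟩
    + 13338 * (+ 4 * α + + 2 * β + π - -1ℤ * M)
      ≡⟨ cong (λ x → + 13338 * (x - -1ℤ * M)) relation ⟩
    + 13338 * (-1ℤ * M - -1ℤ * M)
      ≡⟨ cong (_*_ (+ 13338)) (+-inverseʳ (-1ℤ * M)) ⟩
    -- Both `+ 13338 * 0ℤ` and `+ 858 * 0ℤ` compute to zero; the second form allows cancelling 858.
    + 858 * 0ℤ
      ∎))
  where
  open ≤-Reasoning
  balance : ∀ M α β π →
    + 858 * M + (+ 36 * (+ 39 * (M + + 38 * α)) + + 18 * (+ 39 * (M + + 38 * β)) + + 1482 * (+ 9 * π - - + 7 * M))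
      ≡ + 13338 * (+ 4 * α + + 2 * β + π - -1ℤ * M)
  balance = solve-∀

-- Finite search for a square, and conclusion

-- A common colour must be `b₁`, so three comparisons decide.
monochromatic? : ∀ b₁ b₂ b₃ b₄ → Dec (Monochromatic b₁ b₂ b₃ b₄)
monochromatic? b₁ b₂ b₃ b₄ = map′ (λ (e₂ , e₃ , e₄) → b₁ , refl , e₂ , e₃ , e₄)
  (λ { (_ , refl , e₂ , e₃ , e₄) → e₂ , e₃ , e₄ })
  ((b₂ ≟ᵇ b₁) ×-dec (b₃ ≟ᵇ b₁) ×-dec (b₄ ≟ᵇ b₁))

distinct? : ∀ (i j k l : Fin n) → Dec (Distinct i j k l)
distinct? i j k l = ¬? (i ≟ᶠ j) ×-dec ¬? (i ≟ᶠ k) ×-dec ¬? (i ≟ᶠ l)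
  ×-dec ¬? (j ≟ᶠ k) ×-dec ¬? (j ≟ᶠ l) ×-dec ¬? (k ≟ᶠ l)

anyVertex? : ∀ n {P : Vertex n → Set} → Decidable P → Dec (∃ P)
anyVertex? zero    P? = map′ ([] ,_) (λ { ([] , x) → x }) (P? [])
anyVertex? (suc n) P? = map′
  (λ { (inj₁ (u , x)) → true ∷ u , x ; (inj₂ (u , x)) → false ∷ u , x })
  (λ { (true ∷ u , x) → inj₁ (u , x) ; (false ∷ u , x) → inj₂ (u , x) })
  (anyVertex? n (P? ∘ (true ∷_)) ⊎-dec anyVertex? n (P? ∘ (false ∷_)))

monochromaticSquare? : ∀ (c : EdgeColouring n) →
  Dec (∃[ u ] ∃[ i ] ∃[ j ] ∃[ k ] ∃[ l ] MonochromaticSquare c u i j k l)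
monochromaticSquare? c = anyVertex? _ λ u → any? λ i → any? λ j → any? λ k → any? λ l →
  distinct? i j k l ×-dec monochromatic? _ _ _ _

-- The `m + m` template positions split into a left and a right half, giving the families `p` and
-- `q`. There are as many positions as coordinates, so the placements include the identity and
-- `mass` is positive.
avoiding-bounds : ∀ m {r₀ r₁ r₂ : Fin m} → r₀ ≢ r₁ → r₁ ≢ r₂ → r₂ ≢ r₀ → (c : EdgeColouring (m ℕ.+ m)) →
  (∀ u i j k l → ¬ MonochromaticSquare c u i j k l) → Bounds m
avoiding-bounds m r₀≢r₁ r₁≢r₂ r₂≢r₀ c avoids =
  mass , α′ , β′ , π′ , mass-positive (m ℕ.+ m) , average-relation reference′ , product′ , adjacent′ , opposite′
  where
  open Averaging (m ℕ.+ m) (m ℕ.+ m) using (mass)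
  open NoMonochromaticSquare c avoids
  left right : Fin m → Fin (m ℕ.+ m)
  left  = _↑ˡ m
  right = m ↑ʳ_
  left≢right : ∀ s t → left s ≢ right t
  left≢right s t eq with () ← trans (sym (splitAt-↑ˡ m s m)) (trans (cong (splitAt m) eq) (splitAt-↑ʳ m m t))
  open Template left right (↑ˡ-injective m _ _) (↑ʳ-injective m _ _) left≢right r₀≢r₁ r₁≢r₂ r₂≢r₀
    renaming (α to α′; β to β′; π to π′; reference to reference′; product-bound to product′;
      adjacent-bound to adjacent′; opposite-bound to opposite′)

theorem1p5 : (c : EdgeColouring 78) →
    ∃[ u ] ∃[ i ] ∃[ j ] ∃[ k ] ∃[ l ]
    ((i ≢ j × i ≢ k × i ≢ l × j ≢ k × j ≢ l × k ≢ l) ×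
    ∃[ col ]
    (colour c u (u ⊕ i ⊕ j) ≡ col ×
    colour c (u ⊕ i ⊕ j) (u ⊕ i ⊕ j ⊕ k ⊕ l) ≡ col ×
    colour c (u ⊕ k ⊕ l) (u ⊕ i ⊕ j ⊕ k ⊕ l) ≡ col ×
    colour c u (u ⊕ k ⊕ l) ≡ col))
-- Existence is decided by exhaustive search, so it is enough to refute the absence of squares. Here
-- 78 = 39 + 39, and the first three indices serve as corners of the triangles.
theorem1p5 c = decidable-stable (monochromaticSquare? c) λ none →
  bounds-contradict (avoiding-bounds 39 {zero} {suc zero} {suc (suc zero)} (λ ()) (λ ()) (λ ()) c
    (λ u i j k l square → none (u , i , j , k , l , square)))
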